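{- Let $k$ be a positive integer and let $n \geq (k-1)^3+1$. Then $\textup{Sav}_n(12\cdots k)=0$; that is, for every permutation $p$ of $\{1,\dots,n\}$, at least one of $p$ and $p^2$ contains the pattern $12\cdots k$.
   Context: A permutation $p$ of length $n$ is written in one-line notation $p=p_1p_2\cdots p_n$, with $p_i=p(i)$. A permutation $p$ contains a pattern $q=q_1\cdots q_k$ (itself a permutation of $\{1,\dots,k\}$) if there are indices $i_1<\cdots<i_k$ such that $p_{i_r}<p_{i_s}$ if and only if $q_r<q_s$; otherwise $p$ avoids $q$. The square $p^2$ is the composition $p^2(i)=p(p(i))$. A permutation $p$ is strongly $q$-avoiding if both $p$ and $p^2$ avoid $q$, and $\textup{Sav}_n(q)$ denotes the number of strongly $q$-avoiding permutations of length $n$. $12\cdots k$ denotes the increasing pattern of length $k$. -}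

module Defs where

open import Data.Fin using (Fin; zero; suc; _<_; punchIn)
open import Data.Fin.Permutation using (Permutation′; _⟨$⟩ʳ_; _∘ₚ_; id; insert; remove; insert-punchIn; insert-remove)
open import Data.Fin.Properties using (_<?_; any?; all?; punchIn-injective)
open import Data.List using (List; []; _∷_; allFin; cartesianProductWith; filter; length)
open import Data.List.Membership.Propositional.Properties using (∈-allFin)
import Data.List.Membership.Setoid as Membership
import Data.List.Membership.Setoid.Properties as Membershipₚ
open import Data.List.Relation.Unary.All using ([])
open import Data.List.Relation.Unary.AllPairs using ([]; _∷_)
open import Data.List.Relation.Unary.Any using (here)
import Data.List.Relation.Unary.Unique.Propositional.Properties as Uniqueₚ
import Data.List.Relation.Unary.Unique.Setoid as UniqueSetoid
import Data.List.Relation.Unary.Unique.Setoid.Properties as UniqueSetoidₚ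
open import Data.Nat using (ℕ; zero; suc)
open import Data.Product using (∃; _×_; _,_)
open import Data.Vec using (Vec; []; _∷_; lookup)
open import Function using (_⇔_; mk⇔; Equivalence)
open import Level using (0ℓ)
open import Relation.Binary.Bundles using (Setoid)
import Relation.Binary.Construct.On as On
open import Relation.Binary.PropositionalEquality using (_≡_; refl; sym; trans; cong; setoid; _→-setoid_)
open import Relation.Nullary using (¬_; Dec; ¬?; _×-dec_; _→-dec_)
open import Relation.Nullary.Decidable using (map′)
open import Relation.Unary using (Decidable)

private
  variable
    k n : ℕ

-- Permutations of {1,…,n} are bijections of Fin n = {0,…,n-1}; shifting positions
-- and values by one does not affect order comparisons or composition.

increasing : (k : ℕ) → Permutation′ k
increasing k = id

_² : Permutation′ n → Permutation′ n
p ² = p ∘ₚ p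

-- lookup i r is the position written iᵣ.
IsOccurrence : Permutation′ n → Permutation′ k → Vec (Fin n) k → Set
IsOccurrence p q i =
  (∀ r s → r < s → lookup i r < lookup i s) ×
  (∀ r s → (p ⟨$⟩ʳ lookup i r) < (p ⟨$⟩ʳ lookup i s) ⇔ (q ⟨$⟩ʳ r) < (q ⟨$⟩ʳ s))

_Contains_ : Permutation′ n → Permutation′ k → Set
p Contains q = ∃ (IsOccurrence p q)

_Avoids_ : Permutation′ n → Permutation′ k → Set
p Avoids q = ¬ (p Contains q)

_StronglyAvoids_ : Permutation′ n → Permutation′ k → Set
p StronglyAvoids q = (p Avoids q) × ((p ²) Avoids q)

anyVec? : ∀ k {P : Vec (Fin n) k → Set} → Decidable P → Dec (∃ P)
anyVec? zero    P? = map′ (λ h → [] , h) (λ { ([] , h) → h }) (P? [])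
anyVec? (suc k) P? =
  map′ (λ { (x , xs , h) → x ∷ xs , h }) (λ { (x ∷ xs , h) → x , xs , h })
       (any? λ x → anyVec? k λ xs → P? (x ∷ xs))

_⇔-dec_ : {A B : Set} → Dec A → Dec B → Dec (A ⇔ B)
A? ⇔-dec B? =
  map′ (λ { (f , g) → mk⇔ f g }) (λ e → Equivalence.to e , Equivalence.from e)
       ((A? →-dec B?) ×-dec (B? →-dec A?))

isOccurrence? : (p : Permutation′ n) (q : Permutation′ k) → Decidable (IsOccurrence p q)
isOccurrence? p q i =
  all? (λ r → all? λ s → (r <? s) →-dec (lookup i r <? lookup i s)) ×-dec
  all? (λ r → all? λ s →
    ((p ⟨$⟩ʳ lookup i r) <? (p ⟨$⟩ʳ lookup i s)) ⇔-dec ((q ⟨$⟩ʳ r) <? (q ⟨$⟩ʳ s)))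

_contains?_ : (p : Permutation′ n) (q : Permutation′ k) → Dec (p Contains q)
p contains? q = anyVec? _ (isOccurrence? p q)

stronglyAvoids? : (q : Permutation′ k) → Decidable {A = Permutation′ n} (_StronglyAvoids q)
stronglyAvoids? q p = ¬? (p contains? q) ×-dec ¬? ((p ²) contains? q)

-- Choose the image of the first element, then a bijection between the remaining ones.
permutations : (n : ℕ) → List (Permutation′ n)
permutations zero    = id ∷ []
permutations (suc n) = cartesianProductWith (insert zero) (allFin (suc n)) (permutations n)

Sav : (n : ℕ) → Permutation′ k → ℕ
Sav n q = length (filter (stronglyAvoids? q) (permutations n))

-- permutations-complete and permutations-unique show that the list has each permutation
-- exactly once up to pointwise equality, so Sav n q is the number of strongly q-avoiding
-- permutations.
permSetoid : ℕ → Setoid 0ℓ 0ℓ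
permSetoid n = On.setoid {B = Permutation′ n} (Fin n →-setoid Fin n) _⟨$⟩ʳ_

insert-cong : ∀ {j j′ : Fin (suc n)} {p p′ : Permutation′ n} → j ≡ j′ →
  (∀ i → p ⟨$⟩ʳ i ≡ p′ ⟨$⟩ʳ i) →
  ∀ i → insert zero j p ⟨$⟩ʳ i ≡ insert zero j′ p′ ⟨$⟩ʳ i
insert-cong refl eq zero = refl
insert-cong {j = j} {p = p} {p′} refl eq (suc i) =
  trans (insert-punchIn zero j p i)
        (trans (cong (punchIn j) (eq i)) (sym (insert-punchIn zero j p′ i)))

insert-injective : ∀ {j j′ : Fin (suc n)} {p p′ : Permutation′ n} →
  (∀ i → insert zero j p ⟨$⟩ʳ i ≡ insert zero j′ p′ ⟨$⟩ʳ i) →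
  j ≡ j′ × (∀ i → p ⟨$⟩ʳ i ≡ p′ ⟨$⟩ʳ i)
insert-injective {j = j} {j′} {p} {p′} eq with eq zero
... | refl = refl , λ i → punchIn-injective j _ _
  (trans (sym (insert-punchIn zero j p i)) (trans (eq (suc i)) (insert-punchIn zero j p′ i)))

permutations-complete : (p : Permutation′ n) → Membership._∈_ (permSetoid n) p (permutations n)
permutations-complete {zero}  p = here λ ()
permutations-complete {suc n} p =
  Membershipₚ.∈-resp-≈ (permSetoid (suc n)) {x = insert zero (p ⟨$⟩ʳ zero) (remove zero p)} {y = p} (insert-remove zero p)
    (Membershipₚ.∈-cartesianProductWith⁺ (setoid (Fin (suc n))) (permSetoid n) (permSetoid (suc n))
      {f = insert zero}
      (λ {j} {j′} {p₁} {p₂} → insert-cong {j = j} {j′} {p₁} {p₂})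
      (∈-allFin (p ⟨$⟩ʳ zero)) (permutations-complete (remove zero p)))

permutations-unique : ∀ n → UniqueSetoid.Unique (permSetoid n) (permutations n)
permutations-unique zero    = [] ∷ []
permutations-unique (suc n) =
  UniqueSetoidₚ.cartesianProductWith⁺ (setoid (Fin (suc n))) (permSetoid n) (permSetoid (suc n))
    (insert zero) (λ {j} {j′} {p} {p′} → insert-injective {j = j} {j′} {p} {p′})
    (Uniqueₚ.allFin⁺ (suc n)) (permutations-unique n)

{-# OPTIONS --safe #-}
-- If f avoids 12⋯k, labelling each position by the length of a longest increasing
-- subsequence of f starting there (not counting the position itself) takes at most k − 1
-- values, and the two ends of an ascent of f always get different labels.  Let a and c be
-- these labellings for p and p².  Then i ↦ (a i , a (p i) , c i) is injective: if i < j agree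
-- in the first coordinate, then p j < p i; agreeing also in the second gives
-- p² i < p² j, so the third coordinates differ.  Hence n ≤ (k − 1)³.
module Submission where

open import Defs
open import Data.Fin using (Fin; zero; toℕ; fromℕ; inject₁; combine; _<_)
open import Data.Fin.Permutation using (Permutation′; _⟨$⟩ʳ_)
open import Data.Fin.Properties
  using (_<?_; <-cmp; <-trans; <-irrefl; <-asym; pigeonhole; combine-injective; toℕ-fromℕ; toℕ-inject₁)
open import Data.List using (length)
open import Data.List.Properties using (filter-none)
open import Data.List.Relation.Unary.All using (universal)
open import Data.Nat using (ℕ; zero; suc; _+_; _∸_; _^_; _≤_)
import Data.Nat as ℕ
open import Data.Nat.Properties using (+-comm)
open import Data.Product using (∃; _×_; _,_; proj₁; proj₂)
open import Data.Sum using (_⊎_; inj₁; inj₂)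
open import Data.Vec using (Vec; []; _∷_; lookup)
open import Data.Vec.Relation.Unary.Linked using (Linked; [-]; _∷_; linked?)
open import Data.Vec.Relation.Unary.Linked.Properties using (lookup⁺)
open import Function using (mk⇔; Injection)
open import Function.Properties.Inverse using (↔⇒↣)
open import Relation.Binary.Definitions using (Transitive; Decidable; tri<; tri≈; tri>)
open import Relation.Binary.PropositionalEquality using (_≡_; _≢_; refl; sym; cong; subst)
open import Relation.Nullary using (¬_; Dec; yes; no; contradiction; _×-dec_)

private
  variable
    m n : ℕ

Ascent : Permutation′ n → Fin n → Fin n → Set
Ascent p i j = i < j × (p ⟨$⟩ʳ i) < (p ⟨$⟩ʳ j)

ascent-trans : (p : Permutation′ n) → Transitive (Ascent p)
ascent-trans p (i<j , pi<pj) (j<k , pj<pk) = <-trans i<j j<k , <-trans pi<pj pj<pk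

ascent? : (p : Permutation′ n) → Decidable (Ascent p)
ascent? p i j = (i <? j) ×-dec ((p ⟨$⟩ʳ i) <? (p ⟨$⟩ʳ j))

-- ℓ counts the positions after i.
ChainFrom : Permutation′ n → Fin n → ℕ → Set
ChainFrom {n} p i ℓ = ∃ λ (v : Vec (Fin n) ℓ) → Linked (Ascent p) (i ∷ v)

chainFrom? : (p : Permutation′ n) (i : Fin n) (ℓ : ℕ) → Dec (ChainFrom p i ℓ)
chainFrom? p i ℓ = anyVec? ℓ λ v → linked? (ascent? p) (i ∷ v)

extend : (p : Permutation′ n) {i j : Fin n} {ℓ : ℕ} →
  Ascent p i j → ChainFrom p j ℓ → ChainFrom p i (suc ℓ)
extend p {j = j} asc (v , chain) = j ∷ v , asc ∷ chain

-- `Linked` relates consecutive entries only; transitivity of ascents extends this to all pairs, and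
-- trichotomy on the indices yields the converse in the order condition.
chain⇒contains : (p : Permutation′ n) {i : Fin n} {ℓ : ℕ} →
  ChainFrom p i ℓ → p Contains increasing (suc ℓ)
chain⇒contains {n} p {i} {ℓ} (v , chain) = w ,
  (λ r s r<s → proj₁ (ascending r<s)) ,
  (λ r s → mk⇔ (reflects r s) (λ r<s → proj₂ (ascending r<s)))
  where
  w : Vec (Fin n) (suc ℓ)
  w = i ∷ v

  ascending : ∀ {r s} → r < s → Ascent p (lookup w r) (lookup w s)
  ascending = lookup⁺ (ascent-trans p) chain

  reflects : ∀ r s → (p ⟨$⟩ʳ lookup w r) < (p ⟨$⟩ʳ lookup w s) → r < s
  reflects r s lt with <-cmp r s
  ... | tri< r<s _ _ = r<s
  ... | tri≈ _ refl _ = contradiction lt (<-irrefl refl)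
  ... | tri> _ _ s<r = contradiction lt (<-asym (proj₂ (ascending s<r)))

-- Search downwards from `m` and stop at the first length with a chain: failure one step higher is
-- already known. The search ends because the empty chain always exists.
height : (p : Permutation′ n) (i : Fin n) (m : ℕ) → ¬ ChainFrom p i m →
  ∃ λ (h : Fin m) → ChainFrom p i (toℕ h) × ¬ ChainFrom p i (suc (toℕ h))
height p i zero    none = contradiction ([] , [-]) none
height p i (suc m) none with chainFrom? p i m
... | yes chain =
  fromℕ m , subst (ChainFrom p i) (sym (toℕ-fromℕ m)) chain ,
  subst (λ x → ¬ ChainFrom p i (suc x)) (sym (toℕ-fromℕ m)) none
... | no  none′ with h , chain , max ← height p i m none′ =
  inject₁ h , subst (ChainFrom p i) (sym (toℕ-inject₁ h)) chain ,
  subst (λ x → ¬ ChainFrom p i (suc x)) (sym (toℕ-inject₁ h)) max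

-- Putting `i` before a longest chain from `j` gives a chain from `i` that is longer by one, so
-- equal labels would contradict maximality at `i`.
ascent-labelling : (p : Permutation′ n) → p Avoids increasing (suc m) →
  ∃ λ (label : Fin n → Fin m) → ∀ {i j} → Ascent p i j → label i ≢ label j
ascent-labelling {n} {m} p avoids = (λ i → proj₁ (heightAt i)) , separates
  where
  heightAt : ∀ i → ∃ λ (h : Fin m) → ChainFrom p i (toℕ h) × ¬ ChainFrom p i (suc (toℕ h))
  heightAt i = height p i m (λ chain → avoids (chain⇒contains p chain))

  separates : ∀ {i j} → Ascent p i j → proj₁ (heightAt i) ≢ proj₁ (heightAt j)
  separates {i} {j} asc eq = proj₂ (proj₂ (heightAt i))
    (subst (λ h → ChainFrom p i (suc (toℕ h))) (sym eq)
      (extend p asc (proj₁ (proj₂ (heightAt j)))))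

¬ascent⇒descent : (p : Permutation′ n) {i j : Fin n} →
  i < j → ¬ Ascent p i j → (p ⟨$⟩ʳ j) < (p ⟨$⟩ʳ i)
¬ascent⇒descent p {i} {j} i<j ¬asc with <-cmp (p ⟨$⟩ʳ i) (p ⟨$⟩ʳ j)
... | tri< pi<pj _ _ = contradiction (i<j , pi<pj) ¬asc
... | tri≈ _ pi≡pj _ = contradiction i<j (<-irrefl (Injection.injective (↔⇒↣ p) pi≡pj))
... | tri> _ _ pj<pi = pj<pi

¬stronglyAvoids : m ^ 3 ℕ.< n → (p : Permutation′ n) → ¬ (p StronglyAvoids increasing (suc m))
¬stronglyAvoids {m} {n} m³<n p (avoids , avoids²)
  with a , a-separates ← ascent-labelling p avoids
     | c , c-separates ← ascent-labelling (p ²) avoids²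
  = collide (pigeonhole m³<n code)
  where
  code : Fin n → Fin (m ^ 3)
  -- `m ^ 3` unfolds to `m * (m * (m * 1))`; the final `zero` fills the trivial factor `Fin 1`.
  code i = combine (a i) (combine (a (p ⟨$⟩ʳ i)) (combine (c i) zero))

  collide : ¬ (∃ λ i → ∃ λ j → i < j × code i ≡ code j)
  collide (i , j , i<j , eq)
    with ai≡aj , eq′ ← combine-injective (a i) _ (a j) _ eq
    with api≡apj , eq″ ← combine-injective (a (p ⟨$⟩ʳ i)) _ (a (p ⟨$⟩ʳ j)) _ eq′
    with ci≡cj , _ ← combine-injective (c i) zero (c j) zero eq″
    = c-separates (i<j , p²i<p²j) ci≡cj
    where
    pj<pi : (p ⟨$⟩ʳ j) < (p ⟨$⟩ʳ i)
    pj<pi = ¬ascent⇒descent p i<j (λ asc → a-separates asc ai≡aj)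

    p²i<p²j : ((p ²) ⟨$⟩ʳ i) < ((p ²) ⟨$⟩ʳ j)
    -- The pair is now `p j < p i`, in reversed order, so the second descent restores the order of
    -- `i` and `j`.
    p²i<p²j = ¬ascent⇒descent p pj<pi (λ asc → a-separates asc (sym api≡apj))

theorem2p1 : (k : ℕ) → 1 ≤ k → (n : ℕ) → (k ∸ 1) ^ 3 + 1 ≤ n →
    (Sav n (increasing k) ≡ 0) ×
    ((p : Permutation′ n) → (p Contains increasing k) ⊎ ((p ²) Contains increasing k))
theorem2p1 (suc m) _ n m³+1≤n =
  cong length (filter-none (stronglyAvoids? q) (universal none (permutations n))) , contains
  where
  q : Permutation′ (suc m)
  q = increasing (suc m)

  none : (p : Permutation′ n) → ¬ (p StronglyAvoids q)
  none = ¬stronglyAvoids (subst (_≤ n) (+-comm (m ^ 3) 1) m³+1≤n)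

  -- Deciding containment turns the refuted conjunction `none p` into a disjunction constructively.
  contains : (p : Permutation′ n) → (p Contains q) ⊎ ((p ²) Contains q)
  contains p with p contains? q | (p ²) contains? q
  ... | yes has | _        = inj₁ has
  ... | no _    | yes has² = inj₂ has²
  ... | no no₁  | no no₂   = contradiction (no₁ , no₂) (none p)
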